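{- For quasi-graded posets the zipping operation preserves the Eulerian property: if $(P,\rho,\bar\zeta)$ is an Eulerian quasi-graded poset with a zipper $x,y,z$, then the zipped quasi-graded poset $(Q,\rho_Q,\bar\zeta_Q)$ is Eulerian.
   Context: A quasi-graded poset $(P,\rho,\bar\zeta)$ consists of a finite poset $P$, a function $\rho:P\to\mathbb N$ with $x<y\Rightarrow\rho(x)<\rho(y)$, and a complex-valued function $\bar\zeta$ in the incidence algebra of $P$ with $\bar\zeta(x,x)=1$ for all $x$; set $\bar\zeta(u,v)=0$ if $u\not\le v$. Write $\rho(x,y)=\rho(y)-\rho(x)$. It is Eulerian if for all $x\le z$ $$\sum_{x\le y\le z}(-1)^{\rho(x,y)}\,\bar\zeta(x,y)\,\bar\zeta(y,z)=\delta_{x,z}.$$ A zipper in $(P,\rho,\bar\zeta)$ consists of three distinct elements $x,y,z$ such that (i) $\rho(x)=\rho(y)=\rho(z)+1$; (ii) $z$ is covered by $x$ and $y$ and by no other element; (iii) for all $v>z$ with $\rho(v)>\rho(x)$, $\bar\zeta(x,v)=\bar\zeta(y,v)=\bar\zeta(z,v)$; (iv) $\bar\zeta(z,x)=\bar\zeta(z,y)=1$. The zipped quasi-graded poset is $Q=(P\setminus\{x,y,z\})\cup\{w\}$ with $w$ a new element. $Q$ inherits the order of $P$ together with the relations $u<_Qw$ if $u<_Px$ or $u<_Py$, and $w<_Qv$ if $x<_Pv$ or $y<_Pv$ (and relations implied by transitivity). $\rho_Q$ is inherited from $P$ with $\rho_Q(w)=\rho(x)$. $\bar\zeta_Q$ is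 inherited from $\bar\zeta$ on pairs not involving $w$, and $\bar\zeta_Q(w,v)=\bar\zeta(x,v)$, $\bar\zeta_Q(u,w)=\bar\zeta(u,x)+\bar\zeta(u,y)-\bar\zeta(u,z)$, $\bar\zeta_Q(w,w)=1$. -}

module Defs where

open import Algebra.Bundles using (CommutativeRing)
open import Data.Bool.Base using (if_then_else_)
open import Data.Empty.Irrelevant using (⊥-elim)
open import Data.List.Base using (List; []; _∷_; map; filter; foldr)
open import Data.List.Membership.Propositional using (_∈_)
open import Data.List.Relation.Unary.All using (All; []; _∷_)
open import Data.List.Relation.Unary.Any using (here; there)
open import Data.List.Relation.Unary.AllPairs using ([]; _∷_)
open import Data.List.Relation.Unary.Unique.Propositional using (Unique)
open import Data.Nat.Base as ℕ using (ℕ; suc; _∸_)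
import Data.Nat.Properties as ℕₚ
open import Data.Product.Base using (_×_; _,_; proj₁; proj₂)
open import Data.Sum.Base using (_⊎_; inj₁; inj₂; [_,_]′)
open import Data.Unit.Base using (⊤; tt)
open import Function.Base using (_∘_)
open import Level using (0ℓ; _⊔_) renaming (suc to lsuc)
open import Relation.Binary.Core using (Rel)
open import Relation.Binary.Construct.Closure.ReflexiveTransitive
  using (Star; ε; _◅_; _◅◅_)
import Relation.Binary.Construct.NonStrictToStrict as NonStrictToStrict
open import Relation.Binary.Definitions using (Decidable; DecidableEquality)
open import Relation.Binary.PropositionalEquality
  using (_≡_; _≢_; refl; sym; isEquivalence)
open import Relation.Binary.Structures using (IsDecPartialOrder)
open import Relation.Nullary using (¬_; Dec; yes; no; does; contradiction)
open import Relation.Nullary.Decidable using (map′; _×-dec_; _⊎-dec_; ¬?)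

-- The values of ζ̄ are taken in an arbitrary commutative ring R, there being no
-- type of complex numbers in the library; R = ℂ is the case of interest.
record QuasiGradedPoset {c ℓ} (R : CommutativeRing c ℓ) : Set (lsuc 0ℓ ⊔ c ⊔ ℓ) where
  private module R = CommutativeRing R
  infix 4 _≤_
  field
    Carrier           : Set
    _≤_               : Rel Carrier 0ℓ
    isDecPartialOrder : IsDecPartialOrder _≡_ _≤_

    elements          : List Carrier
    elements-unique   : Unique elements
    elements-complete : ∀ v → v ∈ elements

  open IsDecPartialOrder isDecPartialOrder public using (_≟_; _≤?_)
  open NonStrictToStrict {A = Carrier} _≡_ _≤_ public using (_<_)

  field
    ρ        : Carrier → ℕ
    ρ-strict : ∀ {u v} → u < v → ρ u ℕ.< ρ v

    ζ̄          : Carrier → Carrier → R.Carrier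
    ζ̄-diagonal : ∀ u → ζ̄ u u R.≈ R.1#
    ζ̄-support  : ∀ u v → ¬ u ≤ v → ζ̄ u v R.≈ R.0#

  infix 4 _⋖_
  _⋖_ : Rel Carrier 0ℓ
  u ⋖ v = u < v × (∀ t → ¬ (u < t × t < v))

  -- Truncated subtraction is the true difference whenever u ≤ v.
  ρ[_,_] : Carrier → Carrier → ℕ
  ρ[ u , v ] = ρ v ∸ ρ u

  interval : Carrier → Carrier → List Carrier
  interval u v = filter (λ t → (u ≤? t) ×-dec (t ≤? v)) elements

module _ {c ℓ} {R : CommutativeRing c ℓ} where

  private module R = CommutativeRing R
  open R using (_≈_; _+_; _*_; _-_; -_; 0#; 1#)
  open import Algebra.Properties.Semiring.Exp R.semiring using (_^_)

  module _ (P : QuasiGradedPoset R) where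
    open QuasiGradedPoset P

    δ : Carrier → Carrier → R.Carrier
    δ u v = if does (u ≟ v) then 1# else 0#

    IsEulerian : Set ℓ
    IsEulerian = ∀ u v → u ≤ v →
      foldr _+_ 0# (map (λ t → (- 1#) ^ ρ[ u , t ] * ζ̄ u t * ζ̄ t v) (interval u v))
        ≈ δ u v

    record IsZipper (x y z : Carrier) : Set ℓ where
      field
        x≢y : x ≢ y
        x≢z : x ≢ z
        y≢z : y ≢ z

        ρx≡ρy   : ρ x ≡ ρ y
        ρx≡ρz+1 : ρ x ≡ suc (ρ z)

        z⋖x        : z ⋖ x
        z⋖y        : z ⋖ y
        only-x-y   : ∀ v → z ⋖ v → v ≡ x ⊎ v ≡ y

        ζ̄x≈ζ̄y : ∀ v → z < v → ρ x ℕ.< ρ v → ζ̄ x v ≈ ζ̄ y v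
        ζ̄y≈ζ̄z : ∀ v → z < v → ρ x ℕ.< ρ v → ζ̄ y v ≈ ζ̄ z v

        ζ̄zx≈1 : ζ̄ z x ≈ 1#
        ζ̄zy≈1 : ζ̄ z y ≈ 1#

  module Zip (P : QuasiGradedPoset R) {x y z : QuasiGradedPoset.Carrier P}
             (zipper : IsZipper P x y z) where
    open QuasiGradedPoset P
    open IsZipper zipper
    private module ≤ = IsDecPartialOrder isDecPartialOrder

    Kept : Carrier → Set
    Kept v = v ≢ x × v ≢ y × v ≢ z

    -- The proof in old is irrelevant, so that distinct elements of Q come from
    -- distinct elements of P.
    data Q : Set where
      w   : Q
      old : (v : Carrier) → .(Kept v) → Q

    infix 4 _◁_ _≤Q_

    data _◁_ : Rel Q 0ℓ where
      inherit : ∀ {u v} .{ku : Kept u} .{kv : Kept v} → u ≤ v → old u ku ◁ old v kv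
      below-x : ∀ {u} .{ku : Kept u} → u < x → old u ku ◁ w
      below-y : ∀ {u} .{ku : Kept u} → u < y → old u ku ◁ w
      above-x : ∀ {v} .{kv : Kept v} → x < v → w ◁ old v kv
      above-y : ∀ {v} .{kv : Kept v} → y < v → w ◁ old v kv

    _≤Q_ : Rel Q 0ℓ
    _≤Q_ = Star _◁_

    ρQ : Q → ℕ
    ρQ w         = ρ x
    ρQ (old v _) = ρ v

    ζ̄Q : Q → Q → R.Carrier
    ζ̄Q w         w         = 1#
    ζ̄Q w         (old v _) = ζ̄ x v
    ζ̄Q (old u _) w         = ζ̄ u x + ζ̄ u y - ζ̄ u z
    ζ̄Q (old u _) (old v _) = ζ̄ u v

    old-injective : ∀ {u v} .{ku : Kept u} .{kv : Kept v} → old u ku ≡ old v kv → u ≡ v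
    old-injective refl = refl

    old-cong : ∀ {u v} .{ku : Kept u} .{kv : Kept v} → u ≡ v → old u ku ≡ old v kv
    old-cong refl = refl

    _≟Q_ : DecidableEquality Q
    w       ≟Q w       = yes refl
    w       ≟Q old _ _ = no λ ()
    old _ _ ≟Q w       = no λ ()
    old u _ ≟Q old v _ = map′ old-cong old-injective (u ≟ v)

    kept? : ∀ v → Dec (Kept v)
    kept? v = ¬? (v ≟ x) ×-dec ¬? (v ≟ y) ×-dec ¬? (v ≟ z)

    kept : List Carrier → List Q
    kept []       = []
    kept (v ∷ vs) with kept? v
    ... | yes k = old v k ∷ kept vs
    ... | no  _ = kept vs

    kept-∌ : ∀ {u} .{ku : Kept u} vs → All (u ≢_) vs → All (old u ku ≢_) (kept vs)
    kept-∌ []       []         = []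
    kept-∌ (v ∷ vs) (u≢v ∷ ps) with kept? v
    ... | yes _ = (u≢v ∘ old-injective) ∷ kept-∌ vs ps
    ... | no  _ = kept-∌ vs ps

    kept-unique : ∀ vs → Unique vs → Unique (kept vs)
    kept-unique []       []       = []
    kept-unique (v ∷ vs) (p ∷ ps) with kept? v
    ... | yes _ = kept-∌ vs p ∷ kept-unique vs ps
    ... | no  _ = kept-unique vs ps

    w∉kept : ∀ vs → All (w ≢_) (kept vs)
    w∉kept []       = []
    w∉kept (v ∷ vs) with kept? v
    ... | yes _ = (λ ()) ∷ w∉kept vs
    ... | no  _ = w∉kept vs

    kept-complete : ∀ {u} .(ku : Kept u) vs → u ∈ vs → old u ku ∈ kept vs
    kept-complete ku (v ∷ vs) u∈ with kept? v
    kept-complete ku (v ∷ vs) (here u≡v) | yes _ = here (old-cong u≡v)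
    kept-complete ku (v ∷ vs) (there u∈) | yes _ = there (kept-complete ku vs u∈)
    kept-complete ku (v ∷ vs) (here refl) | no ¬k = ⊥-elim (¬k ku)
    kept-complete ku (v ∷ vs) (there u∈) | no _  = kept-complete ku vs u∈

    elementsQ : List Q
    elementsQ = w ∷ kept elements

    elementsQ-complete : ∀ q → q ∈ elementsQ
    elementsQ-complete w         = here refl
    elementsQ-complete (old v k) = there (kept-complete k elements (elements-complete v))

    Down Up : Carrier → Set
    Down u = u < x ⊎ u < y
    Up   v = x < v ⊎ y < v

    -- A closed form of _≤Q_, from which decidability and antisymmetry follow.
    Explicit : Rel Q 0ℓ
    Explicit w         w         = ⊤
    Explicit w         (old v _) = Up v
    Explicit (old u _) w         = Down u
    Explicit (old u _) (old v _) = u ≤ v ⊎ (Down u × Up v)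

    ≤-<-trans : ∀ {s t r} → s ≤ t → t < r → s < r
    ≤-<-trans = NonStrictToStrict.≤-<-trans _≡_ _≤_ ≤.trans ≤.antisym ≤.≤-respˡ-≈

    <-≤-trans : ∀ {s t r} → s < t → t ≤ r → s < r
    <-≤-trans = NonStrictToStrict.<-≤-trans _≡_ _≤_ sym ≤.trans ≤.antisym ≤.≤-respʳ-≈

    Down-≤ : ∀ {s t} → s ≤ t → Down t → Down s
    Down-≤ s≤t = [ inj₁ ∘ ≤-<-trans s≤t , inj₂ ∘ ≤-<-trans s≤t ]′

    Up-≤ : ∀ {s t} → s ≤ t → Up s → Up t
    Up-≤ s≤t (inj₁ x<s) = inj₁ (<-≤-trans x<s s≤t)
    Up-≤ s≤t (inj₂ y<s) = inj₂ (<-≤-trans y<s s≤t)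

    from-w : ∀ {u} .{ku : Kept u} r → Down u → Explicit w r → Explicit (old u ku) r
    from-w w         d _  = d
    from-w (old _ _) d up = inj₂ (d , up)

    to-w : ∀ {v} .{kv : Kept v} r → Up v → Explicit (old v kv) r → Explicit w r
    to-w w         _  _               = tt
    to-w (old _ _) up (inj₁ v≤r)      = Up-≤ v≤r up
    to-w (old _ _) _  (inj₂ (_ , up)) = up

    step : ∀ {s t} r → s ◁ t → Explicit t r → Explicit s r
    step w         (inherit u≤v) d               = Down-≤ u≤v d
    step (old _ _) (inherit u≤v) (inj₁ v≤r)      = inj₁ (≤.trans u≤v v≤r)
    step (old _ _) (inherit u≤v) (inj₂ (d , up)) = inj₂ (Down-≤ u≤v d , up)
    step r         (below-x u<x) e               = from-w r (inj₁ u<x) e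
    step r         (below-y u<y) e               = from-w r (inj₂ u<y) e
    step r         (above-x x<v) e               = to-w r (inj₁ x<v) e
    step r         (above-y y<v) e               = to-w r (inj₂ y<v) e

    ≤Q⇒Explicit : ∀ {s t} → s ≤Q t → Explicit s t
    ≤Q⇒Explicit {w}       ε        = tt
    ≤Q⇒Explicit {old _ _} ε        = inj₁ ≤.refl
    ≤Q⇒Explicit {_} {t}   (s ◅ ss) = step t s (≤Q⇒Explicit ss)

    down : ∀ {u} .{ku : Kept u} → Down u → old u ku ≤Q w
    down (inj₁ u<x) = below-x u<x ◅ ε
    down (inj₂ u<y) = below-y u<y ◅ ε

    up : ∀ {v} .{kv : Kept v} → Up v → w ≤Q old v kv
    up (inj₁ x<v) = above-x x<v ◅ ε
    up (inj₂ y<v) = above-y y<v ◅ ε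

    Explicit⇒≤Q : ∀ s t → Explicit s t → s ≤Q t
    Explicit⇒≤Q w         w         _              = ε
    Explicit⇒≤Q w         (old _ _) u              = up u
    Explicit⇒≤Q (old _ _) w         d              = down d
    Explicit⇒≤Q (old _ _) (old _ _) (inj₁ u≤v)     = inherit u≤v ◅ ε
    Explicit⇒≤Q (old _ _) (old _ _) (inj₂ (d , u)) = down d ◅◅ up u

    _<?_ : Decidable _<_
    u <? v = (u ≤? v) ×-dec ¬? (u ≟ v)

    Explicit? : Decidable Explicit
    Explicit? w         w         = yes tt
    Explicit? w         (old v _) = (x <? v) ⊎-dec (y <? v)
    Explicit? (old u _) w         = (u <? x) ⊎-dec (u <? y)
    Explicit? (old u _) (old v _) =
      (u ≤? v) ⊎-dec (((u <? x) ⊎-dec (u <? y)) ×-dec ((x <? v) ⊎-dec (y <? v)))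

    _≤Q?_ : Decidable _≤Q_
    s ≤Q? t = map′ (Explicit⇒≤Q s t) ≤Q⇒Explicit (Explicit? s t)

    ρ-Down : ∀ {u} → Down u → ρ u ℕ.< ρ x
    ρ-Down (inj₁ u<x) = ρ-strict u<x
    ρ-Down (inj₂ u<y) = ℕₚ.<-≤-trans (ρ-strict u<y) (ℕₚ.≤-reflexive (sym ρx≡ρy))

    ρ-Up : ∀ {v} → Up v → ρ x ℕ.< ρ v
    ρ-Up (inj₁ x<v) = ρ-strict x<v
    ρ-Up (inj₂ y<v) = ℕₚ.≤-<-trans (ℕₚ.≤-reflexive ρx≡ρy) (ρ-strict y<v)

    ≡⊎ρ< : ∀ s t → Explicit s t → s ≡ t ⊎ ρQ s ℕ.< ρQ t
    ≡⊎ρ< w         w         _              = inj₁ refl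
    ≡⊎ρ< w         (old _ _) u              = inj₂ (ρ-Up u)
    ≡⊎ρ< (old _ _) w         d              = inj₂ (ρ-Down d)
    ≡⊎ρ< (old _ _) (old _ _) (inj₂ (d , u)) = inj₂ (ℕₚ.<-trans (ρ-Down d) (ρ-Up u))
    ≡⊎ρ< (old u _) (old v _) (inj₁ u≤v) with u ≟ v
    ... | yes u≡v = inj₁ (old-cong u≡v)
    ... | no  u≢v = inj₂ (ρ-strict (u≤v , u≢v))

    ρQ-strict : ∀ {s t} → s ≤Q t → s ≢ t → ρQ s ℕ.< ρQ t
    ρQ-strict {s} {t} s≤t s≢t with ≡⊎ρ< s t (≤Q⇒Explicit s≤t)
    ... | inj₁ s≡t = contradiction s≡t s≢t
    ... | inj₂ lt  = lt

    ≤Q-antisym : ∀ {s t} → s ≤Q t → t ≤Q s → s ≡ t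
    ≤Q-antisym {s} {t} s≤t t≤s with s ≟Q t
    ... | yes s≡t = s≡t
    ... | no  s≢t = contradiction (ρQ-strict t≤s (s≢t ∘ sym)) (ℕₚ.<-asym (ρQ-strict s≤t s≢t))

    ≤Q-isDecPartialOrder : IsDecPartialOrder _≡_ _≤Q_
    ≤Q-isDecPartialOrder = record
      { isPartialOrder = record
        { isPreorder = record
          { isEquivalence = isEquivalence
          ; reflexive     = λ { refl → ε }
          ; trans         = _◅◅_
          }
        ; antisym = ≤Q-antisym
        }
      ; _≟_  = _≟Q_
      ; _≤?_ = _≤Q?_
      }

    ζ̄Q-diagonal : ∀ s → ζ̄Q s s ≈ 1#
    ζ̄Q-diagonal w         = R.refl
    ζ̄Q-diagonal (old v _) = ζ̄-diagonal v

    ζ̄Q-support : ∀ s t → ¬ s ≤Q t → ζ̄Q s t ≈ 0#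
    ζ̄Q-support w w s≰t = contradiction ε s≰t
    ζ̄Q-support w (old v k) s≰t = ζ̄-support x v λ x≤v →
      s≰t (up (inj₁ (x≤v , λ x≡v → ⊥-elim (proj₁ k (sym x≡v)))))
    ζ̄Q-support (old u k) w s≰t =
      R.trans (R.+-cong (R.+-cong (ζ̄-support u x u≰x) (ζ̄-support u y u≰y))
                        (R.-‿cong (ζ̄-support u z u≰z)))
      (R.trans (R.+-congʳ (R.+-identityˡ 0#)) (R.-‿inverseʳ 0#))
      where
      u≰x : ¬ u ≤ x
      u≰x u≤x = s≰t (down (inj₁ (u≤x , λ u≡x → ⊥-elim (proj₁ k u≡x))))
      u≰y : ¬ u ≤ y
      u≰y u≤y = s≰t (down (inj₂ (u≤y , λ u≡y → ⊥-elim (proj₁ (proj₂ k) u≡y))))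
      u≰z : ¬ u ≤ z
      u≰z u≤z = u≰x (≤.trans u≤z (proj₁ (proj₁ z⋖x)))
    ζ̄Q-support (old u _) (old v _) s≰t =
      ζ̄-support u v λ u≤v → s≰t (inherit u≤v ◅ ε)

  zipped : (P : QuasiGradedPoset R) {x y z : QuasiGradedPoset.Carrier P} →
           IsZipper P x y z → QuasiGradedPoset R
  zipped P zipper = record
    { Carrier           = Q
    ; _≤_               = _≤Q_
    ; isDecPartialOrder = ≤Q-isDecPartialOrder
    ; elements          = elementsQ
    ; elements-unique   = w∉kept elements ∷ kept-unique elements elements-unique
    ; elements-complete = elementsQ-complete
    ; ρ                 = ρQ
    ; ρ-strict          = λ (s≤t , s≢t) → ρQ-strict s≤t s≢t
    ; ζ̄                 = ζ̄Q
    ; ζ̄-diagonal        = ζ̄Q-diagonal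
    ; ζ̄-support         = ζ̄Q-support
    }
    where
    open QuasiGradedPoset P using (elements; elements-unique)
    open Zip P zipper

{-# OPTIONS --safe #-}

-- Write ζ and D for the P × P matrices ζ̄ and diag((-1)^ρ). Since ζ̄ vanishes
-- off ≤, the Eulerian property says ζ D ζ = D. Now ζ_Q = L ζ C, where L is the
-- Q × P matrix with rows e_x at w and e_u at old u, and C is the P × Q matrix
-- with columns e_x + e_y - e_z at w and e_v at old v. The rows x, y, z of ζ C
-- all agree with the row w of ζ_Q, and D takes the values s, s, -s at x, y, z.
-- Hence the terms x, y, z of the product (L ζ) D (ζ C) add up to the term w of
-- ζ_Q D_Q ζ_Q, so that ζ_Q D_Q ζ_Q = L ζ D ζ C = L D C = D_Q.

module Submission where

open import Defs
open import Algebra.Bundles using (CommutativeRing)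
open import Data.Bool.Base using (if_then_else_)
open import Data.Empty.Irrelevant using (⊥-elim)
open import Data.List.Base using (List; []; _∷_; map; filter; foldr)
open import Data.List.Membership.Propositional using (_∈_)
open import Data.List.Relation.Unary.All as All using (All; []; _∷_)
open import Data.List.Relation.Unary.Any using (here; there)
open import Data.List.Relation.Unary.AllPairs using ([]; _∷_)
open import Data.List.Relation.Unary.Unique.Propositional using (Unique)
open import Data.Nat.Base as ℕ using (ℕ; zero; suc; _∸_)
import Data.Nat.Properties as ℕₚ
open import Data.Product.Base using (_×_; _,_; proj₁; proj₂)
open import Data.Sum.Base using (inj₁; inj₂)
open import Function.Base using (_∘_)
open import Relation.Binary.PropositionalEquality as ≡ using (_≡_; _≢_)
open import Relation.Binary.Structures using (IsDecPartialOrder)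
open import Relation.Nullary using (¬_; Dec; yes; no; does; contradiction)
open import Relation.Nullary.Decidable using (_×-dec_)
open import Relation.Unary using (Pred; Decidable)

-- Finite sums over lists in a commutative ring.

module ListSum {c ℓ} (R : CommutativeRing c ℓ) where
  open CommutativeRing R
  open import Algebra.Properties.Ring ring using (-‿+-comm; -0#≈0#)
  open import Algebra.Properties.CommutativeSemigroup +-commutativeSemigroup
    using (interchange)

  ∑ : ∀ {a} {A : Set a} → List A → (A → Carrier) → Carrier
  ∑ xs f = foldr _+_ 0# (map f xs)

  module _ {a} {A : Set a} where

    ∑-cong : ∀ xs {f g : A → Carrier} → (∀ t → f t ≈ g t) → ∑ xs f ≈ ∑ xs g
    ∑-cong []       f≈g = refl
    ∑-cong (t ∷ xs) f≈g = +-cong (f≈g t) (∑-cong xs f≈g)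

    ∑-zero : ∀ {xs} {f : A → Carrier} → All (λ t → f t ≈ 0#) xs → ∑ xs f ≈ 0#
    ∑-zero []       = refl
    ∑-zero (p ∷ ps) = trans (+-cong p (∑-zero ps)) (+-identityˡ 0#)

    ∑-distrib-+ : ∀ xs (f g : A → Carrier) → ∑ xs (λ t → f t + g t) ≈ ∑ xs f + ∑ xs g
    ∑-distrib-+ []       f g = sym (+-identityˡ 0#)
    ∑-distrib-+ (t ∷ xs) f g =
      trans (+-congˡ (∑-distrib-+ xs f g)) (interchange _ _ _ _)

    ∑-neg : ∀ xs (f : A → Carrier) → ∑ xs (λ t → - f t) ≈ - ∑ xs f
    ∑-neg []       f = sym -0#≈0#
    ∑-neg (t ∷ xs) f = trans (+-congˡ (∑-neg xs f)) (-‿+-comm _ _)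

    *-distribˡ-∑ : ∀ xs r (f : A → Carrier) → ∑ xs (λ t → r * f t) ≈ r * ∑ xs f
    *-distribˡ-∑ []       r f = sym (zeroʳ r)
    *-distribˡ-∑ (t ∷ xs) r f = trans (+-congˡ (*-distribˡ-∑ xs r f)) (sym (distribˡ r _ _))

    -- `f` and `g` need agree only where `P` holds, so that membership in an interval is at hand
    -- when its sign is split in `interval-sum`.
    ∑-filter : ∀ {p} {P : Pred A p} (P? : Decidable P) xs {f g : A → Carrier} →
               (∀ t → P t → f t ≈ g t) → (∀ t → ¬ P t → g t ≈ 0#) →
               ∑ (filter P? xs) f ≈ ∑ xs g
    ∑-filter P? []       f≈g g≈0 = refl
    ∑-filter P? (t ∷ xs) f≈g g≈0 with P? t
    ... | yes p = +-cong (f≈g t p) (∑-filter P? xs f≈g g≈0)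
    ... | no ¬p = trans (∑-filter P? xs f≈g g≈0)
                    (sym (trans (+-congʳ (g≈0 t ¬p)) (+-identityˡ _)))

    ∑-single : ∀ {xs} {f : A → Carrier} {u} → Unique xs → u ∈ xs →
               (∀ t → t ≢ u → f t ≈ 0#) → ∑ xs f ≈ f u
    ∑-single (u∉ ∷ _) (here ≡.refl) f≈0 =
      trans (+-congˡ (∑-zero (All.map (λ u≢t → f≈0 _ (u≢t ∘ ≡.sym)) u∉))) (+-identityʳ _)
    ∑-single (t∉ ∷ us) (there u∈) f≈0 =
      trans (+-cong (f≈0 _ (All.lookup t∉ u∈)) (∑-single us u∈ f≈0)) (+-identityˡ _)

-- Powers of -1.

module Sign {c ℓ} (R : CommutativeRing c ℓ) where
  open CommutativeRing R
  open import Algebra.Properties.Ring ring using (-1*x≈-x; -‿involutive)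
  open import Algebra.Properties.Semiring.Exp semiring using (_^_; ^-homo-*)
  open import Algebra.Properties.CommutativeSemigroup *-commutativeSemigroup
    using (interchange)
  open import Relation.Binary.Reasoning.Setoid setoid

  sign : ℕ → Carrier
  sign n = (- 1#) ^ n

  sign-suc : ∀ n → sign (suc n) ≈ - sign n
  sign-suc n = -1*x≈-x (sign n)

  sign-square : ∀ n → sign n * sign n ≈ 1#
  sign-square zero    = *-identityˡ 1#
  sign-square (suc n) = begin
    (- 1# * sign n) * (- 1# * sign n)  ≈⟨ interchange _ _ _ _ ⟩
    (- 1# * - 1#) * (sign n * sign n)  ≈⟨ *-cong (-1*x≈-x (- 1#)) (sign-square n) ⟩
    - - 1# * 1#                        ≈⟨ *-identityʳ _ ⟩
    - - 1#                             ≈⟨ -‿involutive 1# ⟩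
    1#                                 ∎

  sign-cancel : ∀ n r → sign n * (sign n * r) ≈ r
  sign-cancel n r = begin
    sign n * (sign n * r)  ≈⟨ *-assoc _ _ _ ⟨
    sign n * sign n * r    ≈⟨ *-congʳ (sign-square n) ⟩
    1# * r                 ≈⟨ *-identityˡ r ⟩
    r                      ∎

  -- `sign m` is its own inverse, so it can be inserted twice; one copy joins `n ∸ m` to give `n`,
  -- as `m ≤ n` makes the truncated difference exact.
  sign-∸ : ∀ {m n} → m ℕ.≤ n → sign (n ∸ m) ≈ sign m * sign n
  sign-∸ {m} {n} m≤n = begin
    sign (n ∸ m)                      ≈⟨ sign-cancel m _ ⟨
    sign m * (sign m * sign (n ∸ m))  ≈⟨ *-congˡ (^-homo-* (- 1#) m (n ∸ m)) ⟨
    sign m * sign (m ℕ.+ (n ∸ m))     ≡⟨ ≡.cong (λ k → sign m * sign k) (ℕₚ.m+[n∸m]≡n m≤n) ⟩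
    sign m * sign n                   ∎

-- The Eulerian property as a matrix identity.

module Convolution {c ℓ} {R : CommutativeRing c ℓ} (P : QuasiGradedPoset R) where
  open CommutativeRing R hiding (Carrier)
  open QuasiGradedPoset P
  open import Relation.Binary.Reasoning.Setoid setoid
  open ListSum R
  open Sign R
  private module ≤ = IsDecPartialOrder isDecPartialOrder

  σ : Carrier → CommutativeRing.Carrier R
  σ u = sign (ρ u)

  -- With `f` a row and `g` a column of `ζ̄`, this is an entry of `ζ D ζ`.
  conv : (f g : Carrier → CommutativeRing.Carrier R) → CommutativeRing.Carrier R
  conv f g = ∑ elements (λ t → σ t * (f t * g t))

  δ-≡ : ∀ u → δ P u u ≈ 1#
  δ-≡ u with u ≟ u
  ... | yes _  = refl
  ... | no u≢u = contradiction ≡.refl u≢u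

  δ-≢ : ∀ {u v} → u ≢ v → δ P u v ≈ 0#
  δ-≢ {u} {v} u≢v with u ≟ v
  ... | yes u≡v = contradiction u≡v u≢v
  ... | no _    = refl

  ρ-mono : ∀ {u v} → u ≤ v → ρ u ℕ.≤ ρ v
  ρ-mono {u} {v} u≤v with u ≟ v
  ... | yes ≡.refl = ℕₚ.≤-refl
  ... | no u≢v     = ℕₚ.<⇒≤ (ρ-strict (u≤v , u≢v))

  outside-interval : ∀ {u t v} → ¬ (u ≤ t × t ≤ v) → σ t * (ζ̄ u t * ζ̄ t v) ≈ 0#
  outside-interval {u} {t} {v} ∉ = trans (*-congˡ product≈0) (zeroʳ _)
    where
    product≈0 : ζ̄ u t * ζ̄ t v ≈ 0#
    product≈0 with u ≤? t
    ... | yes u≤t = trans (*-congˡ (ζ̄-support t v (λ t≤v → ∉ (u≤t , t≤v)))) (zeroʳ _)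
    ... | no  u≰t = trans (*-congʳ (ζ̄-support u t u≰t)) (zeroˡ _)

  -- The sign of `ρ[ u , t ]` factors as `σ u * σ t`, which frees `σ u` from the sum; the support of
  -- `ζ̄` then lets `t` range over all elements.
  interval-sum : ∀ u v →
    ∑ (interval u v) (λ t → sign ρ[ u , t ] * ζ̄ u t * ζ̄ t v)
      ≈ σ u * conv (ζ̄ u) (λ t → ζ̄ t v)
  interval-sum u v = trans
    (∑-filter (λ t → (u ≤? t) ×-dec (t ≤? v)) elements inside
      (λ t ∉ → trans (*-congˡ (outside-interval ∉)) (zeroʳ _)))
    (*-distribˡ-∑ elements (σ u) _)
    where
    inside : ∀ t → u ≤ t × t ≤ v →
      sign ρ[ u , t ] * ζ̄ u t * ζ̄ t v ≈ σ u * (σ t * (ζ̄ u t * ζ̄ t v))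
    inside t (u≤t , _) = begin
      sign ρ[ u , t ] * ζ̄ u t * ζ̄ t v  ≈⟨ *-assoc _ _ _ ⟩
      sign ρ[ u , t ] * (ζ̄ u t * ζ̄ t v)  ≈⟨ *-congʳ (sign-∸ (ρ-mono u≤t)) ⟩
      σ u * σ t * (ζ̄ u t * ζ̄ t v)        ≈⟨ *-assoc _ _ _ ⟩
      σ u * (σ t * (ζ̄ u t * ζ̄ t v))      ∎

  -- The Eulerian property speaks of `u ≤ v` only. For other pairs no `t` satisfies `u ≤ t ≤ v`, so
  -- every summand is 0, and so is `δ`.
  Eulerian⇒conv : IsEulerian P → ∀ u v → conv (ζ̄ u) (λ t → ζ̄ t v) ≈ σ u * δ P u v
  Eulerian⇒conv eulerian u v with u ≤? v
  ... | yes u≤v = begin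
    conv (ζ̄ u) (λ t → ζ̄ t v)                  ≈⟨ sign-cancel (ρ u) _ ⟨
    σ u * (σ u * conv (ζ̄ u) (λ t → ζ̄ t v))    ≈⟨ *-congˡ (interval-sum u v) ⟨
    σ u * ∑ (interval u v) (λ t → sign ρ[ u , t ] * ζ̄ u t * ζ̄ t v)
                                              ≈⟨ *-congˡ (eulerian u v u≤v) ⟩
    σ u * δ P u v                             ∎
  ... | no u≰v = begin
    conv (ζ̄ u) (λ t → ζ̄ t v)  ≈⟨ ∑-zero (All.universal (λ _ →
                                   outside-interval λ (u≤t , t≤v) → u≰v (≤.trans u≤t t≤v))
                                   elements) ⟩
    0#                        ≈⟨ zeroʳ _ ⟨
    σ u * 0#                  ≈⟨ *-congˡ (δ-≢ (u≰v ∘ ≤.reflexive)) ⟨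
    σ u * δ P u v             ∎

  conv⇒Eulerian : (∀ u v → conv (ζ̄ u) (λ t → ζ̄ t v) ≈ σ u * δ P u v) → IsEulerian P
  conv⇒Eulerian conv≈ u v _ =
    trans (interval-sum u v) (trans (*-congˡ (conv≈ u v)) (sign-cancel (ρ u) _))

module Zipping {c ℓ} {R : CommutativeRing c ℓ} (P : QuasiGradedPoset R)
               {x y z : QuasiGradedPoset.Carrier P} (zipper : IsZipper P x y z) where
  open CommutativeRing R hiding (Carrier)
  open QuasiGradedPoset P
  open IsZipper zipper
  open Zip P zipper
  open import Algebra.Properties.Ring ring
    using (-‿distribˡ-*; -‿involutive; x[y-z]≈xy-xz; [y-z]x≈yx-zx; -0#≈0#; xyx⁻¹≈y)
  open import Relation.Binary.Reasoning.Setoid setoid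
  open ListSum R
  open Sign R
  open Convolution P
  private
    module ≤ = IsDecPartialOrder isDecPartialOrder
    module Qᶜ = Convolution (zipped P zipper)
    Scalar = CommutativeRing.Carrier R

  -- The order and the values of `ζ̄` around the zipper.

  ρ≤⇒≰ : ∀ {u v} → u ≢ v → ρ v ℕ.≤ ρ u → ¬ u ≤ v
  ρ≤⇒≰ u≢v ρv≤ρu u≤v = ℕₚ.<⇒≱ (ρ-strict (u≤v , u≢v)) ρv≤ρu

  x≰y : ¬ x ≤ y
  x≰y = ρ≤⇒≰ x≢y (ℕₚ.≤-reflexive (≡.sym ρx≡ρy))

  y≰x : ¬ y ≤ x
  y≰x = ρ≤⇒≰ (x≢y ∘ ≡.sym) (ℕₚ.≤-reflexive ρx≡ρy)

  x≰z : ¬ x ≤ z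
  x≰z = ρ≤⇒≰ x≢z (ρ-mono (proj₁ (proj₁ z⋖x)))

  y≰z : ¬ y ≤ z
  y≰z = ρ≤⇒≰ y≢z (ρ-mono (proj₁ (proj₁ z⋖y)))

  -- An element above z that has the rank of x covers z, hence is x or y.
  z<kept⇒ρx< : ∀ {v} → .(Kept v) → z < v → ρ x ℕ.< ρ v
  z<kept⇒ρx< {v} k z<v = ℕₚ.≤∧≢⇒< ρx≤ρv ρx≢ρv
    where
    ρx≤ρv : ρ x ℕ.≤ ρ v
    ρx≤ρv = ≡.subst (ℕ._≤ ρ v) (≡.sym ρx≡ρz+1) (ρ-strict z<v)

    ρx≢ρv : ρ x ≢ ρ v
    -- No `t` fits between `z` and `v`: its rank would lie strictly between the consecutive numbers
    -- `ρ z` and `ρ v`.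
    ρx≢ρv ρx≡ρv with only-x-y v (z<v , λ t (z<t , t<v) →
      ℕₚ.<⇒≱ (ρ-strict t<v) (ℕₚ.≤-trans
        (ℕₚ.≤-reflexive (≡.trans (≡.sym ρx≡ρv) ρx≡ρz+1)) (ρ-strict z<t)))
    ... | inj₁ v≡x = ⊥-elim (proj₁ k v≡x)
    ... | inj₂ v≡y = ⊥-elim (proj₁ (proj₂ k) v≡y)

  ≤⇒<-kept : ∀ {v} → .(Kept v) → z ≤ v → z < v
  ≤⇒<-kept k z≤v = z≤v , λ z≡v → ⊥-elim (proj₂ (proj₂ k) (≡.sym z≡v))

  z≰⇒x≰ : ∀ {v} → ¬ z ≤ v → ¬ x ≤ v
  z≰⇒x≰ z≰v x≤v = z≰v (≤.trans (proj₁ (proj₁ z⋖x)) x≤v)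

  z≰⇒y≰ : ∀ {v} → ¬ z ≤ v → ¬ y ≤ v
  z≰⇒y≰ z≰v y≤v = z≰v (≤.trans (proj₁ (proj₁ z⋖y)) y≤v)

  -- If `z ≤ v`, then `v` has rank above that of `x` and the zipper condition applies. Otherwise
  -- neither `x` nor `y` lies below `v`, both being above `z`, and both values are 0.
  ζ̄y≈ζ̄x : ∀ {v} → .(Kept v) → ζ̄ y v ≈ ζ̄ x v
  ζ̄y≈ζ̄x {v} k with z ≤? v
  ... | yes z≤v = let z<v = ≤⇒<-kept k z≤v in sym (ζ̄x≈ζ̄y v z<v (z<kept⇒ρx< k z<v))
  ... | no  z≰v = trans (ζ̄-support y v (z≰⇒y≰ z≰v)) (sym (ζ̄-support x v (z≰⇒x≰ z≰v)))

  ζ̄z≈ζ̄x : ∀ {v} → .(Kept v) → ζ̄ z v ≈ ζ̄ x v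
  ζ̄z≈ζ̄x {v} k with z ≤? v
  ... | yes z≤v = let z<v = ≤⇒<-kept k z≤v in
    trans (sym (ζ̄y≈ζ̄z v z<v (z<kept⇒ρx< k z<v))) (ζ̄y≈ζ̄x k)
  ... | no  z≰v = trans (ζ̄-support z v z≰v) (sym (ζ̄-support x v (z≰⇒x≰ z≰v)))

  -- The factorization of `ζ̄Q` as `L ζ C`.

  rep : Q → Carrier
  rep w         = x
  rep (old u _) = u

  -- The entry at `q` of the row vector `f` times `C`. The matrix `L` appears only through `rep`,
  -- which gives the row of `ζ` that it selects.
  _·C_ : (Carrier → Scalar) → Q → Scalar
  f ·C w       = f x + f y - f z
  f ·C old v _ = f v

  ·C-cong : ∀ {f g} q → (∀ v → f v ≈ g v) → f ·C q ≈ g ·C q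
  ·C-cong w         f≈g = +-cong (+-cong (f≈g x) (f≈g y)) (-‿cong (f≈g z))
  ·C-cong (old v _) f≈g = f≈g v

  ·C-*ˡ : ∀ r f q → (λ v → r * f v) ·C q ≈ r * (f ·C q)
  ·C-*ˡ r f w = begin
    r * f x + r * f y - r * f z  ≈⟨ +-congʳ (distribˡ r _ _) ⟨
    r * (f x + f y) - r * f z    ≈⟨ x[y-z]≈xy-xz r _ _ ⟨
    r * (f x + f y - f z)        ∎
  ·C-*ˡ r f (old _ _) = refl

  ·C-∑ : ∀ {a} {A : Set a} xs (f : A → Carrier → Scalar) q →
         ∑ xs (λ t → f t ·C q) ≈ (λ v → ∑ xs (λ t → f t v)) ·C q
  ·C-∑ xs f w = trans (∑-distrib-+ xs _ _) (+-cong (∑-distrib-+ xs _ _) (∑-neg xs _))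
  ·C-∑ xs f (old _ _) = refl

  -- Associativity of the matrix product: `·C` is a fixed linear combination of entries, so it
  -- commutes with the sum.
  conv-·C : ∀ f q → conv f (λ t → ζ̄ t ·C q) ≈ (λ v → conv f (λ t → ζ̄ t v)) ·C q
  conv-·C f q = trans
    (∑-cong elements λ t → trans (*-congˡ (sym (·C-*ˡ (f t) (ζ̄ t) q)))
                                 (sym (·C-*ˡ (σ t) (λ v → f t * ζ̄ t v) q)))
    (·C-∑ elements (λ t v → σ t * (f t * ζ̄ t v)) q)

  a+0-0 : ∀ {a b d} → b ≈ 0# → d ≈ 0# → a + b - d ≈ a
  a+0-0 {a} {b} {d} b≈0 d≈0 = begin
    a + b - d    ≈⟨ +-cong (+-congˡ b≈0) (-‿cong d≈0) ⟩
    a + 0# - 0#  ≈⟨ +-cong (+-identityʳ a) -0#≈0# ⟩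
    a + 0#       ≈⟨ +-identityʳ a ⟩
    a            ∎

  -- At `w` only the diagonal term survives, since `x ≤ y` and `x ≤ z` both fail.
  ζ̄x·C≈ζ̄Qw : ∀ q → ζ̄ x ·C q ≈ ζ̄Q w q
  ζ̄x·C≈ζ̄Qw w         = trans (a+0-0 (ζ̄-support x y x≰y) (ζ̄-support x z x≰z)) (ζ̄-diagonal x)
  ζ̄x·C≈ζ̄Qw (old _ _) = refl

  ζ̄y·C≈ζ̄Qw : ∀ q → ζ̄ y ·C q ≈ ζ̄Q w q
  ζ̄y·C≈ζ̄Qw w = begin
    ζ̄ y x + ζ̄ y y - ζ̄ y z  ≈⟨ +-congʳ (+-comm _ _) ⟩
    ζ̄ y y + ζ̄ y x - ζ̄ y z  ≈⟨ a+0-0 (ζ̄-support y x y≰x) (ζ̄-support y z y≰z) ⟩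
    ζ̄ y y                  ≈⟨ ζ̄-diagonal y ⟩
    1#                     ∎
  ζ̄y·C≈ζ̄Qw (old _ k) = ζ̄y≈ζ̄x k

  -- At `w` the values `ζ̄ z x`, `ζ̄ z y` and `ζ̄ z z` are all 1, so the entry is 1 + 1 - 1.
  ζ̄z·C≈ζ̄Qw : ∀ q → ζ̄ z ·C q ≈ ζ̄Q w q
  ζ̄z·C≈ζ̄Qw w =
    trans (+-cong (+-cong ζ̄zx≈1 ζ̄zy≈1) (-‿cong (ζ̄-diagonal z))) (xyx⁻¹≈y 1# 1#)
  ζ̄z·C≈ζ̄Qw (old _ k) = ζ̄z≈ζ̄x k

  ζ̄Q≈ζ̄·C : ∀ s q → ζ̄Q s q ≈ ζ̄ (rep s) ·C q
  ζ̄Q≈ζ̄·C w         q         = sym (ζ̄x·C≈ζ̄Qw q)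
  ζ̄Q≈ζ̄·C (old _ _) w         = refl
  ζ̄Q≈ζ̄·C (old _ _) (old _ _) = refl

  -- This is `L C = 1`: `rep` never takes the values `y` and `z`, so the terms that they contribute
  -- to the column `w` are 0.
  δ·C≈δQ : ∀ s q → δ P (rep s) ·C q ≈ δ (zipped P zipper) s q
  δ·C≈δQ w         w         = trans (a+0-0 (δ-≢ x≢y) (δ-≢ x≢z)) (δ-≡ x)
  δ·C≈δQ w         (old v k) = δ-≢ λ x≡v → ⊥-elim (proj₁ k (≡.sym x≡v))
  δ·C≈δQ (old u k) w         = trans
    (a+0-0 (δ-≢ λ u≡y → ⊥-elim (proj₁ (proj₂ k) u≡y))
           (δ-≢ λ u≡z → ⊥-elim (proj₂ (proj₂ k) u≡z)))
    (δ-≢ λ u≡x → ⊥-elim (proj₁ k u≡x))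
  δ·C≈δQ (old _ _) (old _ _) = refl

  -- Signs and sums over the two posets.

  σ-rep : ∀ s → σ (rep s) ≈ Qᶜ.σ s
  σ-rep w         = refl
  σ-rep (old _ _) = refl

  σy≈σx : σ y ≈ σ x
  σy≈σx = reflexive (≡.cong sign (≡.sym ρx≡ρy))

  σz≈-σx : σ z ≈ - σ x
  σz≈-σx = begin
    σ z                 ≈⟨ -‿involutive (σ z) ⟨
    - - σ z             ≈⟨ -‿cong (sign-suc (ρ z)) ⟨
    - sign (suc (ρ z))  ≡⟨ ≡.cong (λ n → - sign n) ρx≡ρz+1 ⟨
    - σ x               ∎

  ∑-kept : ∀ vs {G : Q → Scalar} {F : Carrier → Scalar} →
           (∀ v .(k : Kept v) → G (old v k) ≈ F v) → (∀ v → ¬ Kept v → F v ≈ 0#) →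
           ∑ (kept vs) G ≈ ∑ vs F
  ∑-kept []       G≈F F≈0 = refl
  ∑-kept (v ∷ vs) G≈F F≈0 with kept? v
  ... | yes k = +-cong (G≈F v k) (∑-kept vs G≈F F≈0)
  ... | no ¬k = trans (∑-kept vs G≈F F≈0) (sym (trans (+-congʳ (F≈0 v ¬k)) (+-identityˡ _)))

  _when_ : ∀ {a} {A : Set a} → Scalar → Dec A → Scalar
  r when d = if does d then r else 0#

  -- The proof of `A` is irrelevant because the proofs of `Kept v` supplied in `∑-kept+xyz` are.
  when-yes : ∀ {a} {A : Set a} {r} (d : Dec A) → .A → r when d ≈ r
  when-yes (yes _) _ = refl
  when-yes (no ¬p) p = ⊥-elim (¬p p)

  when-no : ∀ {a} {A : Set a} {r} (d : Dec A) → ¬ A → r when d ≈ 0#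
  when-no (yes p) ¬p = contradiction p ¬p
  when-no (no _)  _  = refl

  module _ (F : Carrier → Scalar) where

    at : Carrier → Carrier → Scalar
    at u t = F t when (t ≟ u)

    onKept : Carrier → Scalar
    onKept t = F t when (kept? t)

    ∑-at : ∀ u → ∑ elements (at u) ≈ F u
    ∑-at u = trans
      (∑-single elements-unique (elements-complete u) (λ t → when-no (t ≟ u)))
      (when-yes (u ≟ u) ≡.refl)

    split : ∀ t → onKept t + (at x t + at y t + at z t) ≈ F t
    split t = cases (t ≟ x) (t ≟ y) (t ≟ z)
      where
      cases : Dec (t ≡ x) → Dec (t ≡ y) → Dec (t ≡ z) →
              onKept t + (at x t + at y t + at z t) ≈ F t
      cases (yes t≡x) _ _ = begin
        onKept t + (at x t + at y t + at z t)
          ≈⟨ +-cong (when-no (kept? t) λ (t≢x , _) → t≢x t≡x)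
               (+-cong (+-cong (when-yes (t ≟ x) t≡x)
                               (when-no (t ≟ y) (x≢y ∘ ≡.trans (≡.sym t≡x))))
                       (when-no (t ≟ z) (x≢z ∘ ≡.trans (≡.sym t≡x)))) ⟩
        0# + (F t + 0# + 0#)  ≈⟨ +-identityˡ _ ⟩
        F t + 0# + 0#         ≈⟨ +-identityʳ _ ⟩
        F t + 0#              ≈⟨ +-identityʳ _ ⟩
        F t                   ∎
      cases (no t≢x) (yes t≡y) _ = begin
        onKept t + (at x t + at y t + at z t)
          ≈⟨ +-cong (when-no (kept? t) λ (_ , t≢y , _) → t≢y t≡y)
               (+-cong (+-cong (when-no (t ≟ x) t≢x) (when-yes (t ≟ y) t≡y))
                       (when-no (t ≟ z) (y≢z ∘ ≡.trans (≡.sym t≡y)))) ⟩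
        0# + (0# + F t + 0#)  ≈⟨ +-identityˡ _ ⟩
        0# + F t + 0#         ≈⟨ +-identityʳ _ ⟩
        0# + F t              ≈⟨ +-identityˡ _ ⟩
        F t                   ∎
      cases (no t≢x) (no t≢y) (yes t≡z) = begin
        onKept t + (at x t + at y t + at z t)
          ≈⟨ +-cong (when-no (kept? t) λ (_ , _ , t≢z) → t≢z t≡z)
               (+-cong (+-cong (when-no (t ≟ x) t≢x) (when-no (t ≟ y) t≢y))
                       (when-yes (t ≟ z) t≡z)) ⟩
        0# + (0# + 0# + F t)  ≈⟨ +-identityˡ _ ⟩
        0# + 0# + F t         ≈⟨ +-congʳ (+-identityˡ 0#) ⟩
        0# + F t              ≈⟨ +-identityˡ _ ⟩
        F t                   ∎
      cases (no t≢x) (no t≢y) (no t≢z) = begin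
        onKept t + (at x t + at y t + at z t)
          ≈⟨ +-cong (when-yes (kept? t) (t≢x , t≢y , t≢z))
               (+-cong (+-cong (when-no (t ≟ x) t≢x) (when-no (t ≟ y) t≢y))
                       (when-no (t ≟ z) t≢z)) ⟩
        F t + (0# + 0# + 0#)  ≈⟨ +-congˡ (trans (+-identityʳ _) (+-identityʳ _)) ⟩
        F t + 0#              ≈⟨ +-identityʳ _ ⟩
        F t                   ∎

    -- All four summands are rewritten as sums over the same list `elements`, with `F` cut off to
    -- the kept elements or to a single one; `split` then compares them term by term.
    ∑-kept+xyz : ∀ {G : Q → Scalar} → (∀ v .(k : Kept v) → G (old v k) ≈ F v) →
                 ∑ (kept elements) G + (F x + F y + F z) ≈ ∑ elements F
    ∑-kept+xyz {G} G≈F = begin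
      ∑ (kept elements) G + (F x + F y + F z)
        ≈⟨ +-cong
             (∑-kept elements (λ v k → trans (G≈F v k) (sym (when-yes (kept? v) k)))
                              (λ v → when-no (kept? v)))
             (+-cong (+-cong (sym (∑-at x)) (sym (∑-at y))) (sym (∑-at z))) ⟩
      ∑ elements onKept + (∑ elements (at x) + ∑ elements (at y) + ∑ elements (at z))
        ≈⟨ +-congˡ (+-congʳ (∑-distrib-+ elements (at x) (at y))) ⟨
      ∑ elements onKept + (∑ elements (λ t → at x t + at y t) + ∑ elements (at z))
        ≈⟨ +-congˡ (∑-distrib-+ elements _ (at z)) ⟨
      ∑ elements onKept + ∑ elements (λ t → at x t + at y t + at z t)
        ≈⟨ ∑-distrib-+ elements onKept _ ⟨
      ∑ elements (λ t → onKept t + (at x t + at y t + at z t))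
        ≈⟨ ∑-cong elements split ⟩
      ∑ elements F
        ∎

  -- The rows `x`, `y` and `z` of `ζ C` equal one row `r`, and the rank of `z`, smaller by one,
  -- supplies a minus sign. The coefficients of `r` therefore assemble to `f x + f y - f z`, which
  -- is `f ·C w`.
  xyz-terms : ∀ f q →
    σ x * (f x * (ζ̄ x ·C q)) + σ y * (f y * (ζ̄ y ·C q)) + σ z * (f z * (ζ̄ z ·C q))
      ≈ σ x * ((f ·C w) * ζ̄Q w q)
  xyz-terms f q = begin
    σ x * (f x * (ζ̄ x ·C q)) + σ y * (f y * (ζ̄ y ·C q)) + σ z * (f z * (ζ̄ z ·C q))
      ≈⟨ +-cong (+-cong (*-congˡ (*-congˡ (ζ̄x·C≈ζ̄Qw q)))
                        (*-cong σy≈σx (*-congˡ (ζ̄y·C≈ζ̄Qw q))))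
                (*-cong σz≈-σx (*-congˡ (ζ̄z·C≈ζ̄Qw q))) ⟩
    σ x * (f x * r) + σ x * (f y * r) + - σ x * (f z * r)
      ≈⟨ +-cong (sym (distribˡ (σ x) _ _)) (sym (-‿distribˡ-* (σ x) _)) ⟩
    σ x * (f x * r + f y * r) - σ x * (f z * r)
      ≈⟨ x[y-z]≈xy-xz (σ x) _ _ ⟨
    σ x * (f x * r + f y * r - f z * r)
      ≈⟨ *-congˡ (+-congʳ (distribʳ r _ _)) ⟨
    σ x * ((f x + f y) * r - f z * r)
      ≈⟨ *-congˡ ([y-z]x≈yx-zx r _ _) ⟨
    σ x * ((f ·C w) * r)
      ∎
    where r = ζ̄Q w q

  conv-zipped : ∀ s q → Qᶜ.conv (ζ̄Q s) (λ t → ζ̄Q t q) ≈ conv (ζ̄ (rep s)) (λ t → ζ̄ t ·C q)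
  conv-zipped s q = begin
    -- The list `elementsQ` begins with `w`, so the sum unfolds to the term of `w` plus the rest.
    σ x * (ζ̄Q s w * ζ̄Q w q) + ∑ (kept elements) G
      ≈⟨ +-comm _ _ ⟩
    ∑ (kept elements) G + σ x * (ζ̄Q s w * ζ̄Q w q)
      ≈⟨ +-congˡ (*-congˡ (*-congʳ (ζ̄Q≈ζ̄·C s w))) ⟩
    ∑ (kept elements) G + σ x * ((ζ̄ (rep s) ·C w) * ζ̄Q w q)
      ≈⟨ +-congˡ (xyz-terms (ζ̄ (rep s)) q) ⟨
    ∑ (kept elements) G + (F x + F y + F z)
      ≈⟨ ∑-kept+xyz F (λ v k → *-congˡ (*-cong (ζ̄Q≈ζ̄·C s (old v k)) (ζ̄Q≈ζ̄·C (old v k) q))) ⟩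
    ∑ elements F
      ∎
    where
    F : Carrier → Scalar
    F t = σ t * (ζ̄ (rep s) t * (ζ̄ t ·C q))
    G : Q → Scalar
    G t = Qᶜ.σ t * (ζ̄Q s t * ζ̄Q t q)

  zipped-Eulerian : IsEulerian P → IsEulerian (zipped P zipper)
  zipped-Eulerian eulerian = Qᶜ.conv⇒Eulerian λ s q → begin
    Qᶜ.conv (ζ̄Q s) (λ t → ζ̄Q t q)               ≈⟨ conv-zipped s q ⟩
    conv (ζ̄ (rep s)) (λ t → ζ̄ t ·C q)           ≈⟨ conv-·C (ζ̄ (rep s)) q ⟩
    -- At `q = w` the columns `x`, `y` and `z` are combined, and `rep s` need not lie below each of
    -- them; hence the identity for all pairs.
    (λ v → conv (ζ̄ (rep s)) (λ t → ζ̄ t v)) ·C q ≈⟨ ·C-cong q (Eulerian⇒conv eulerian (rep s)) ⟩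
    (λ v → σ (rep s) * δ P (rep s) v) ·C q      ≈⟨ ·C-*ˡ (σ (rep s)) (δ P (rep s)) q ⟩
    σ (rep s) * (δ P (rep s) ·C q)              ≈⟨ *-cong (σ-rep s) (δ·C≈δQ s q) ⟩
    Qᶜ.σ s * δ (zipped P zipper) s q            ∎

theorem5p9 : ∀ {c ℓ} (R : CommutativeRing c ℓ) (P : QuasiGradedPoset R)
    (x y z : QuasiGradedPoset.Carrier P) (zipper : IsZipper P x y z) →
    IsEulerian P → IsEulerian (zipped P zipper)
theorem5p9 R P x y z zipper = Zipping.zipped-Eulerian P zipper
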